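{- For every BPPS instance (with $k$ a valid upper bound on the number of bins and $\mathcal B=\{1,\dots,k\}$), an optimal solution to the linear program $\mathrm{LP}^{\dagger}_{\mathrm N}$ is $$x_{ib}=\frac1k\ \ (i\in\mathcal I,\ b\in\mathcal B),\qquad y_{cb}=\frac{\gamma_c}{k}\ \ (c\in\mathcal C,\ b\in\mathcal B),\qquad z_b=\frac{\sum_{i\in\mathcal I}w_i+\sum_{c\in\mathcal C}\gamma_c\,s_c}{k\,d}\ \ (b\in\mathcal B),$$ and its optimal objective function value is $$\zeta(\mathrm{LP}^{\dagger}_{\mathrm N})=\frac{r}{d}\Big(\sum_{i\in\mathcal I}w_i+\sum_{c\in\mathcal C}\gamma_c\,s_c\Big)+\sum_{c\in\mathcal C}\gamma_c\,f_c.$$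
   Context: Bin Packing Problem with Setups (BPPS). An instance consists of: a bin capacity $d\in\mathbb Z_{\ge1}$; items $\mathcal I=\{1,\dots,n\}$ with weights $w_i\in\mathbb Z_{\ge1}$; classes $\mathcal C=\{1,\dots,m\}$ and a partition $\{\mathcal I_1,\dots,\mathcal I_m\}$ of $\mathcal I$ into (nonempty) classes; for each class $c$ a setup weight $s_c\in\mathbb Z_{\ge0}$ and a setup cost $f_c\in\mathbb Z_{\ge0}$; a bin cost $r\in\mathbb Z_{\ge1}$. It is assumed that $w_i+s_c\le d$ for all $c\in\mathcal C$, $i\in\mathcal I_c$, and that the items cannot all be packed in a single bin, i.e. $\sum_{i\in\mathcal I}w_i+\sum_{c\in\mathcal C}s_c>d$. For $S\subseteq\mathcal I$ let $\mathcal C(S)=\{c\in\mathcal C: S\cap\mathcal I_c\neq\emptyset\}$. A packing pattern is a subset $S\subseteq\mathcal I$ with $\sum_{i\in S}w_i+\sum_{c\in\mathcal C(S)}s_c\le d$. A feasible solution is a partition $\mathcal S$ of $\mathcal I$ into (nonempty) packing patterns (used bins); its cost is $r|\mathcal S|+\sum_{S\in\mathcal S}\sum_{c\in\mathcal C(S)}f_c$. The problem is to find a feasible solution of minimum cost. For $c\in\mathcal C$ let $\gamma_c=\left\lceil\frac{\sum_{i\in\mathcal I_c}w_i}{d-s_c}\right\rceil$. Let $k\in\mathbb Z_{\ge1}$ be an upper bound on the number of bins used in any optimal BPPS solution and $\mathcal B=\{1,\dots,k\}$. The linear program $\mathrm{LP}^{\dagger}_{\mathrm N}$ is: minimize $\sum_{b\in\mathcal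 B}\big(r z_b+\sum_{c\in\mathcal C}f_c y_{cb}\big)$ subject to - $\sum_{b\in\mathcal B}x_{ib}=1$ for all $i\in\mathcal I$; - $\sum_{i\in\mathcal I}w_ix_{ib}+\sum_{c\in\mathcal C}s_cy_{cb}\le d\,z_b$ for all $b\in\mathcal B$; - $x_{ib}\le y_{cb}$ for all $c\in\mathcal C$, $i\in\mathcal I_c$, $b\in\mathcal B$; - $\sum_{b\in\mathcal B}y_{cb}\ge\gamma_c$ for all $c\in\mathcal C$ (Minimum Classes Inequalities); - $0\le x_{ib}\le1$, $0\le y_{cb}\le1$, $0\le z_b\le1$ for all $i\in\mathcal I,c\in\mathcal C,b\in\mathcal B$. $\zeta(\mathrm{LP}^{\dagger}_{\mathrm N})$ denotes its optimal objective function value. -}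

module Defs where

open import Algebra.Bundles using (CommutativeRing)
import Algebra.Definitions.RawMonoid as RawMonoidDefs
import Algebra.Properties.Semiring.Sum as SemiringSum
open import Data.Bool.Base using (if_then_else_)
open import Data.Fin.Base using (Fin)
open import Data.Fin.Subset using (Subset; _∈_; _∩_; Nonempty)
open import Data.Fin.Subset.Properties using (nonempty?)
open import Data.Integer.Base using (+_; ∣_∣)
open import Data.Nat.Base as ℕ using (ℕ; _∸_; NonZero; >-nonZero)
open import Data.Nat.Properties using (+-*-semiring; m<n⇒0<n∸m; +-monoˡ-≤; ≤-trans)
open import Data.Product using (_×_; _,_; ∃; ∃!)
open import Data.Rational.Unnormalised.Base as ℚᵘ using (ceiling)
open import Data.Vec.Base using (lookup; tabulate)
open import Level using (Level; _⊔_) renaming (suc to lsuc)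
open import Relation.Binary.Core using (Rel)
open import Relation.Binary.PropositionalEquality using (_≡_)
open import Relation.Binary.Structures using (IsTotalOrder)
open import Relation.Nullary using (¬_; does)

open SemiringSum +-*-semiring public using () renaming (sum to sumℕ)

sumOver : ∀ {n} → Subset n → (Fin n → ℕ) → ℕ
sumOver S v = sumℕ λ i → if lookup S i then v i else 0

record IsPartition {n p : ℕ} (P : Fin p → Subset n) : Set where
  field
    nonempty : ∀ b → Nonempty (P b)
    unique   : ∀ i → ∃! _≡_ λ b → i ∈ P b

-- The Bin Packing Problem with Setups.  A solution with p bins is a partition
-- indexed by Fin p; I c is the set of items of class c.
record BPPS : Set where
  field
    d n m     : ℕ
    d≥1       : 1 ℕ.≤ d
    w         : Fin n → ℕ
    w≥1       : ∀ i → 1 ℕ.≤ w i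
    I         : Fin m → Subset n
    partition : IsPartition I
    s f       : Fin m → ℕ
    r         : ℕ
    r≥1       : 1 ℕ.≤ r
    fits      : ∀ c i → i ∈ I c → w i ℕ.+ s c ℕ.≤ d
    not-one   : d ℕ.< sumℕ w ℕ.+ sumℕ s

  s<d : ∀ c → s c ℕ.< d
  s<d c with IsPartition.nonempty partition c
  ... | i , i∈Ic = ≤-trans (+-monoˡ-≤ (s c) (w≥1 i)) (fits c i i∈Ic)

  d∸s-nonZero : ∀ c → NonZero (d ∸ s c)
  d∸s-nonZero c = >-nonZero (m<n⇒0<n∸m (s<d c))

  classes : Subset n → Subset m
  classes S = tabulate λ c → does (nonempty? (S ∩ I c))

  IsPattern : Subset n → Set
  IsPattern S = sumOver S w ℕ.+ sumOver (classes S) s ℕ.≤ d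

  IsFeasible : ∀ {p} → (Fin p → Subset n) → Set
  IsFeasible S = IsPartition S × (∀ b → IsPattern (S b))

  cost : ∀ {p} → (Fin p → Subset n) → ℕ
  cost {p} S = r ℕ.* p ℕ.+ sumℕ λ b → sumOver (classes (S b)) f

  IsOptimal : ∀ {p} → (Fin p → Subset n) → Set
  IsOptimal S = IsFeasible S ×
    (∀ {q} (T : Fin q → Subset n) → IsFeasible T → cost S ℕ.≤ cost T)

  BoundsOptimalBins : ℕ → Set
  BoundsOptimalBins k = ∀ {p} (S : Fin p → Subset n) → IsOptimal S → p ℕ.≤ k

  -- The ceiling is a non-negative integer, so ∣_∣ only changes its type to ℕ.
  γ : Fin m → ℕ
  γ c = ∣ ceiling (ℚᵘ._/_ (+ sumOver (I c) w) (d ∸ s c) {{d∸s-nonZero c}}) ∣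

  load : ℕ
  load = sumℕ w ℕ.+ sumℕ λ c → γ c ℕ.* s c

-- Linear programs are stated over an arbitrary ordered field, because the
-- library has no real numbers; ℝ and ℚ are both instances.
record OrderedField (a ℓ₁ ℓ₂ : Level) : Set (lsuc (a ⊔ ℓ₁ ⊔ ℓ₂)) where
  infix 8 _⁻¹
  infixl 7 _/_
  infix 4 _≤_
  field
    commutativeRing : CommutativeRing a ℓ₁

  open CommutativeRing commutativeRing public

  -- The inverse is total, but its value at 0# is unconstrained.
  field
    _≤_          : Rel Carrier ℓ₂
    isTotalOrder : IsTotalOrder _≈_ _≤_
    +-mono-≤     : ∀ {x y} z → x ≤ y → x + z ≤ y + z
    *-nonNeg     : ∀ {x y} → 0# ≤ x → 0# ≤ y → 0# ≤ x * y
    0≉1          : ¬ 0# ≈ 1#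
    _⁻¹          : Carrier → Carrier
    ⁻¹-cong      : ∀ {x y} → x ≈ y → x ⁻¹ ≈ y ⁻¹
    *-inverseʳ   : ∀ {x} → ¬ x ≈ 0# → x * x ⁻¹ ≈ 1#

  _/_ : Carrier → Carrier → Carrier
  x / y = x * y ⁻¹

  open SemiringSum semiring public using (sum)

  ⟦_⟧ : ℕ → Carrier
  ⟦ j ⟧ = RawMonoidDefs._×_ +-rawMonoid j 1#

module LP {a ℓ₁ ℓ₂} (K : OrderedField a ℓ₁ ℓ₂) (P : BPPS) (k : ℕ) where
  open OrderedField K
  open BPPS P

  record Point : Set a where
    constructor point
    field
      x : Fin n → Fin k → Carrier
      y : Fin m → Fin k → Carrier
      z : Fin k → Carrier

  objective : Point → Carrier
  objective p = sum λ b → ⟦ r ⟧ * z b + sum λ c → ⟦ f c ⟧ * y c b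
    where open Point p

  record Feasible (p : Point) : Set (ℓ₁ ⊔ ℓ₂) where
    open Point p
    field
      assignment  : ∀ i → sum (λ b → x i b) ≈ 1#
      capacity    : ∀ b → sum (λ i → ⟦ w i ⟧ * x i b) + sum (λ c → ⟦ s c ⟧ * y c b)
                          ≤ ⟦ d ⟧ * z b
      setup       : ∀ c i → i ∈ I c → ∀ b → x i b ≤ y c b
      min-classes : ∀ c → ⟦ γ c ⟧ ≤ sum (λ b → y c b)
      x-bounds    : ∀ i b → 0# ≤ x i b × x i b ≤ 1#
      y-bounds    : ∀ c b → 0# ≤ y c b × y c b ≤ 1#
      z-bounds    : ∀ b → 0# ≤ z b × z b ≤ 1#

  IsOptimalSolution : Point → Set (a ⊔ ℓ₁ ⊔ ℓ₂)
  IsOptimalSolution p = Feasible p × (∀ q → Feasible q → objective p ≤ objective q)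

  IsOptimalValue : Carrier → Set (a ⊔ ℓ₁ ⊔ ℓ₂)
  IsOptimalValue v = ∃ λ p → IsOptimalSolution p × objective p ≈ v

{-# OPTIONS --safe #-}
-- Lower bound: the capacity constraints give r z_b ≥ (r / d) (Σ_i w_i x_ib +
-- Σ_c s_c y_cb); summing over b and using Σ_b x_ib = 1 and Σ_b y_cb ≥ γ_c
-- bounds every objective value below by the claimed optimum.  The even point
-- turns all of these inequalities into equalities.
--
-- The even point satisfies y, z ≤ 1 because in a feasible packing with p bins
-- the items of class c weigh at most d − s_c in each bin, so c occurs in at
-- least γ_c bins: hence γ_c ≤ p, and load ≤ p d by adding up the bin loads.
-- Take p from an optimal packing, so that p ≤ k.  Such a packing exists up to
-- double negation, which is enough as ≤ on ℕ is decidable.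
module Submission where

open import Defs
import Algebra.Properties.Ring as RingProperties
import Algebra.Properties.Semiring.Mult as SemiringMult
import Algebra.Properties.Semiring.Sum as SemiringSum
open import Data.Bool.Base using (Bool; true; false; if_then_else_)
open import Data.Fin.Base using (Fin; zero; suc; punchIn)
open import Data.Fin.Properties using (punchInᵢ≢i)
open import Data.Fin.Subset using (Subset; _∈_; _∩_; Nonempty; ⁅_⁆)
open import Data.Fin.Subset.Properties
  using (nonempty?; x∈p∩q⁺; x∈p∩q⁻; x∈⁅x⁆; x∈⁅y⁆⇒x≡y)
open import Data.Integer.Base as ℤ using (+_; ∣_∣)
open import Data.Integer.DivMod using (div-pos-is-/ℕ)
import Data.Integer.Properties as ℤₚ
open import Data.Nat.Base as ℕ using (ℕ; zero; suc; _∸_; NonZero; z≤n; s≤s)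
open import Data.Nat.DivMod using (m≡m%n+[m/n]*n; m*n/n≡m; /-monoˡ-≤)
open import Data.Nat.Induction using (<-wellFounded)
import Data.Nat.Properties as ℕₚ
open import Data.Product.Base using (_×_; _,_; proj₁; proj₂; ∃; Σ-syntax)
open import Data.Rational.Unnormalised.Base as ℚᵘ using (ceiling)
open import Data.Sum.Base using (inj₁; inj₂)
open import Data.Vec.Base using (lookup)
open import Data.Vec.Functional.Relation.Binary.Pointwise.Properties using (foldr-cong)
open import Data.Vec.Properties using ([]=⇒lookup; lookup⇒[]=; lookup∘tabulate)
open import Induction.WellFounded using (Acc; acc)
open import Relation.Binary.Bundles using (Poset)
open import Relation.Binary.PropositionalEquality as ≡ using (_≡_; _≢_; module ≡-Reasoning)
import Relation.Binary.Reasoning.PartialOrder as ≤-Reasoning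
open import Relation.Binary.Structures using (IsTotalOrder)
open import Relation.Nullary using (¬_; yes; no; contradiction)
open import Relation.Nullary.Decidable using (dec-true; decidable-stable)

-- Minima of natural-valued functions and ceilings of quotients.

module Σℕ = SemiringSum ℕₚ.+-*-semiring

-- Infinite descent: without a minimum, every value would be undercut by a smaller one. The double
-- negation remains because `A` is arbitrary and the existence of a smaller value is not decidable.
¬¬-minimum : ∀ {ℓ} {A : Set ℓ} (μ : A → ℕ) → A → ¬ ¬ (∃ λ a → ∀ b → μ a ℕ.≤ μ b)
¬¬-minimum {A = A} μ a₀ noMin = descend a₀ (<-wellFounded (μ a₀))
  where
  descend : ∀ a → ¬ Acc ℕ._<_ (μ a)
  descend a (acc smaller) = noMin (a , λ b → ℕₚ.≮⇒≥ λ b<a → descend b (smaller b<a))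

-- The ceiling of q is defined as minus the floor of -q, and the outer sign disappears under the
-- absolute value. The form with `/ℕ` computes by cases on the remainder of `a`.
∣⌈a/n⌉∣≡∣-a/n∣ : ∀ a n .{{_ : NonZero n}} → ∣ ceiling (+ a ℚᵘ./ n) ∣ ≡ ∣ (ℤ.- + a) ℤ./ℕ n ∣
∣⌈a/n⌉∣≡∣-a/n∣ a n@(suc _) =
  ≡.trans (ℤₚ.∣-i∣≡∣i∣ ((ℤ.- + a) ℤ./ + n)) (≡.cong ∣_∣ (div-pos-is-/ℕ (ℤ.- + a) n))

∣⌈a/n⌉∣≤q : ∀ a n q .{{_ : NonZero n}} → a ℕ.≤ q ℕ.* n → ∣ ceiling (+ a ℚᵘ./ n) ∣ ℕ.≤ q
∣⌈a/n⌉∣≤q a n q a≤qn = ≡.subst (ℕ._≤ q) (≡.sym (∣⌈a/n⌉∣≡∣-a/n∣ a n)) (bound a a≤qn)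
  where
  bound : ∀ a → a ℕ.≤ q ℕ.* n → ∣ (ℤ.- + a) ℤ./ℕ n ∣ ℕ.≤ q
  bound zero      _    = ℕₚ.≤-trans (/-monoˡ-≤ n z≤n) (ℕₚ.≤-reflexive (m*n/n≡m q n))
  bound a@(suc _) a≤qn with a ℕ.% n in eq
  ... | zero  = ≡.subst (ℕ._≤ q) (≡.sym (ℤₚ.∣-i∣≡∣i∣ (+ (a ℕ./ n))))
                  (ℕₚ.≤-trans (/-monoˡ-≤ n a≤qn) (ℕₚ.≤-reflexive (m*n/n≡m q n)))
  -- With a nonzero remainder the absolute value is `suc (a / n)`, so the goal is the strict bound
  -- `a / n < q`; the remainder makes `a / n * n` strictly smaller than `a`.
  ... | suc r = ℕₚ.*-cancelʳ-< n (a ℕ./ n) q (begin-strict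
    a ℕ./ n ℕ.* n              <⟨ ℕₚ.m<n+m _ (s≤s z≤n) ⟩
    suc r ℕ.+ a ℕ./ n ℕ.* n    ≡⟨ ≡.cong (ℕ._+ a ℕ./ n ℕ.* n) eq ⟨
    a ℕ.% n ℕ.+ a ℕ./ n ℕ.* n  ≡⟨ m≡m%n+[m/n]*n a n ⟨
    a                          ≤⟨ a≤qn ⟩
    q ℕ.* n                    ∎)
    where open ℕₚ.≤-Reasoning

1≤∣⌈a/n⌉∣ : ∀ a n .{{_ : NonZero n}} → 1 ℕ.≤ a → 1 ℕ.≤ ∣ ceiling (+ a ℚᵘ./ n) ∣
1≤∣⌈a/n⌉∣ a n 1≤a = ≡.subst (1 ℕ.≤_) (≡.sym (∣⌈a/n⌉∣≡∣-a/n∣ a n)) (bound a 1≤a)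
  where
  bound : ∀ a → 1 ℕ.≤ a → 1 ℕ.≤ ∣ (ℤ.- + a) ℤ./ℕ n ∣
  bound a@(suc _) _ with a ℕ.% n in eq
  ... | suc r = s≤s z≤n
  ... | zero  = ≡.subst (1 ℕ.≤_) (≡.sym (ℤₚ.∣-i∣≡∣i∣ (+ (a ℕ./ n)))) m%n≡0⇒1≤m/n
    where
    m%n≡0⇒1≤m/n : 1 ℕ.≤ a ℕ./ n
    m%n≡0⇒1≤m/n with a ℕ./ n | m≡m%n+[m/n]*n a n
    ... | suc _ | _ = s≤s z≤n
    -- Quotient and remainder both zero would force the positive `a` to be 0.
    ... | zero  | a≡a%n = contradiction (≡.trans a≡a%n (≡.cong (ℕ._+ 0) eq)) λ ()

-- Finite sums of natural numbers, over index sets, subsets and partitions.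

sum-mono-≤ : ∀ {n} {t u : Fin n → ℕ} → (∀ i → t i ℕ.≤ u i) → sumℕ t ℕ.≤ sumℕ u
sum-mono-≤ = foldr-cong {R = ℕ._≤_} {S = ℕ._≤_} ℕₚ.+-mono-≤ z≤n

sum-≤-const : ∀ {n c} {t : Fin n → ℕ} → (∀ i → t i ℕ.≤ c) → sumℕ t ℕ.≤ n ℕ.* c
sum-≤-const {zero}  t≤c = z≤n
sum-≤-const {suc n} t≤c = ℕₚ.+-mono-≤ (t≤c zero) (sum-≤-const λ i → t≤c (suc i))

term≤sum : ∀ {n} (t : Fin n → ℕ) i → t i ℕ.≤ sumℕ t
term≤sum t zero    = ℕₚ.m≤m+n (t zero) _
term≤sum t (suc i) = ℕₚ.m≤n⇒m≤o+n (t zero) (term≤sum (λ j → t (suc j)) i)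

sum-singleton : ∀ {n} (t : Fin n → ℕ) i → (∀ j → j ≢ i → t j ≡ 0) → sumℕ t ≡ t i
sum-singleton {suc n} t i t≡0 = begin
  sumℕ t                                 ≡⟨ Σℕ.sum-remove {i = i} t ⟩
  t i ℕ.+ sumℕ (λ j → t (punchIn i j))   ≡⟨ ≡.cong (t i ℕ.+_) (Σℕ.sum-cong-≗ λ j → t≡0 _ (punchInᵢ≢i i j)) ⟩
  t i ℕ.+ sumℕ {n} (λ _ → 0)             ≡⟨ ≡.cong (t i ℕ.+_) (Σℕ.sum-replicate-zero n) ⟩
  t i ℕ.+ 0                              ≡⟨ ℕₚ.+-identityʳ (t i) ⟩
  t i                                    ∎
  where open ≡-Reasoning

if-≤ : ∀ b v → (if b then v else 0) ℕ.≤ v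
if-≤ true  v = ℕₚ.≤-refl
if-≤ false v = z≤n

module _ {n : ℕ} where

  if-∈ : ∀ {S : Subset n} {i} v → i ∈ S → (if lookup S i then v else 0) ≡ v
  if-∈ v i∈S = ≡.cong (if_then v else 0) ([]=⇒lookup i∈S)

  if-∉ : ∀ {S : Subset n} {i} v → ¬ i ∈ S → (if lookup S i then v else 0) ≡ 0
  if-∉ {S} {i} v i∉S with lookup S i in eq
  ... | true  = contradiction (lookup⇒[]= i S eq) i∉S
  ... | false = ≡.refl

  sumOver-mono-≤ : ∀ (S : Subset n) {t u : Fin n → ℕ} → (∀ {i} → i ∈ S → t i ℕ.≤ u i) →
                   sumOver S t ℕ.≤ sumOver S u
  sumOver-mono-≤ S {t} {u} t≤u = sum-mono-≤ bound
    where
    bound : ∀ i → (if lookup S i then t i else 0) ℕ.≤ (if lookup S i then u i else 0)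
    bound i with lookup S i in eq
    ... | true  = t≤u (lookup⇒[]= i S eq)
    ... | false = z≤n

  term≤sumOver : ∀ {S : Subset n} {i} v → i ∈ S → v i ℕ.≤ sumOver S v
  term≤sumOver {S} {i} v i∈S = ≡.subst (ℕ._≤ sumOver S v) (if-∈ (v i) i∈S) (term≤sum _ i)

  sumOver-≤-singleton : ∀ {S : Subset n} {i} v → (∀ {j} → j ∈ S → j ≡ i) → sumOver S v ℕ.≤ v i
  sumOver-≤-singleton {S} {i} v S⊆i = ℕₚ.≤-trans
    (ℕₚ.≤-reflexive (sum-singleton _ i λ j j≢i → if-∉ (v j) λ j∈S → j≢i (S⊆i j∈S)))
    (if-≤ (lookup S i) (v i))

  -- Double counting: each element lies in exactly one block, so its value is the sum of its
  -- contributions to all blocks; exchanging the two sums groups these by block.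
  sum-partition : ∀ {p} {S : Fin p → Subset n} → IsPartition S →
                  ∀ v → sumℕ v ≡ sumℕ λ b → sumOver (S b) v
  sum-partition {p} {S} part v = ≡.trans (Σℕ.sum-cong-≗ once) (Σℕ.∑-comm {n} {p} _)
    where
    once : ∀ i → v i ≡ sumℕ λ b → if lookup (S b) i then v i else 0
    once i with b , i∈Sb , b-unique ← IsPartition.unique part i = ≡.sym (≡.trans
      (sum-singleton _ b λ b′ b′≢b → if-∉ (v i) λ i∈Sb′ → b′≢b (≡.sym (b-unique i∈Sb′)))
      (if-∈ (v i) i∈Sb))

-- Turns membership into a 0/1 factor, so that a common weight can be pulled out of a sum over bins.
indicator : Bool → ℕ
indicator b = if b then 1 else 0

if≡indicator* : ∀ b v → (if b then v else 0) ≡ indicator b ℕ.* v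
if≡indicator* true  v = ≡.sym (ℕₚ.*-identityˡ v)
if≡indicator* false v = ≡.refl

-- Feasible packings and the bounds they give on the number of bins.

module Packings (P : BPPS) where
  open BPPS P

  -- A class has an item, and items have positive weight. This yields `x ≤ y` at the even point.
  1≤γ : ∀ c → 1 ℕ.≤ γ c
  1≤γ c with i , i∈Ic ← IsPartition.nonempty partition c =
    1≤∣⌈a/n⌉∣ (sumOver (I c) w) (d ∸ s c) {{d∸s-nonZero c}}
      (ℕₚ.≤-trans (w≥1 i) (term≤sumOver w i∈Ic))

  ∈-classes⁻ : ∀ {S c} → c ∈ classes S → Nonempty (S ∩ I c)
  ∈-classes⁻ {S} {c} c∈
    with nonempty? (S ∩ I c) | ≡.trans (≡.sym (lookup∘tabulate _ c)) ([]=⇒lookup c∈)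
  ... | yes meets | _  = meets
  ... | no _      | ()

  ∈-classes⁺ : ∀ {S c} → Nonempty (S ∩ I c) → c ∈ classes S
  ∈-classes⁺ {S} {c} meets = lookup⇒[]= c _ (≡.trans (lookup∘tabulate _ c) (dec-true (nonempty? (S ∩ I c)) meets))

  -- One bin per item fits by the hypothesis `fits`, as the item brings only its own class. It is
  -- the starting point of the minimisation of `cost`.
  singletons-feasible : IsFeasible (⁅_⁆ {n})
  singletons-feasible = record
    { nonempty = λ i → i , x∈⁅x⁆ i
    ; unique   = λ i → i , x∈⁅x⁆ i , λ {j} i∈⁅j⁆ → x∈⁅y⁆⇒x≡y j i∈⁅j⁆
    } , pattern′
    where
    pattern′ : ∀ i → IsPattern ⁅ i ⁆
    pattern′ i with c , i∈Ic , c-unique ← IsPartition.unique partition i =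
      ℕₚ.≤-trans
        (ℕₚ.+-mono-≤ (sumOver-≤-singleton w (x∈⁅y⁆⇒x≡y i)) (sumOver-≤-singleton s only-c))
        (fits c i i∈Ic)
      where
      only-c : ∀ {c′} → c′ ∈ classes ⁅ i ⁆ → c′ ≡ c
      only-c c′∈ with j , j∈ ← ∈-classes⁻ c′∈ with j∈⁅i⁆ , j∈Ic′ ← x∈p∩q⁻ ⁅ i ⁆ _ j∈ =
        ≡.sym (c-unique (≡.subst (_∈ I _) (x∈⁅y⁆⇒x≡y i j∈⁅i⁆) j∈Ic′))

  ¬¬-optimal : ¬ ¬ (∃ λ p → Σ[ S ∈ (Fin p → Subset n) ] IsOptimal S)
  ¬¬-optimal noOptimal =
    ¬¬-minimum {A = ∃ λ p → Σ[ S ∈ (Fin p → Subset n) ] IsFeasible S}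
      (λ (_ , S , _) → cost S) (n , ⁅_⁆ , singletons-feasible)
      λ ((p , S , feasible) , minimal) →
        noOptimal (p , S , feasible , λ {q} T T-feasible → minimal (q , T , T-feasible))

  module _ {p} {S : Fin p → Subset n} (feasible : IsFeasible S) where

    -- The 0/1 value of the variable y for class `c` and bin `b` in the packing `S`.
    uses : Fin m → Fin p → ℕ
    uses c b = indicator (lookup (classes (S b)) c)

    -- The weights of class `c` extended by zero to all items: `sumOver (I c) w` is then a sum over
    -- all items, and `sum-partition` can split it by bin.
    classWeight : Fin m → Fin n → ℕ
    classWeight c i = if lookup (I c) i then w i else 0

    -- If the bin contains class `c`, its setup weight is charged there and leaves at most `d ∸ s c`
    -- for items; otherwise the bin has no item of the class.
    classWeight-in-bin : ∀ c b → sumOver (S b) (classWeight c) ℕ.≤ uses c b ℕ.* (d ∸ s c)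
    classWeight-in-bin c b with lookup (classes (S b)) c in eq
    ... | true  = ℕₚ.≤-trans (ℕₚ.m+n≤o⇒m≤o∸n _ (begin
      sumOver (S b) (classWeight c) ℕ.+ s c
        ≤⟨ ℕₚ.+-mono-≤ (sumOver-mono-≤ (S b) λ {i} _ → if-≤ (lookup (I c) i) (w i))
                       (term≤sumOver {S = classes (S b)} s (lookup⇒[]= c _ eq)) ⟩
      sumOver (S b) w ℕ.+ sumOver (classes (S b)) s
        ≤⟨ proj₂ feasible b ⟩
      d ∎)) (ℕₚ.≤-reflexive (≡.sym (ℕₚ.*-identityˡ (d ∸ s c))))
      where open ℕₚ.≤-Reasoning
    -- Here the right-hand side computes to 0, so it suffices that each of the `n` terms is at most
    -- 0.
    ... | false = ≡.subst (sumOver (S b) (classWeight c) ℕ.≤_) (ℕₚ.*-zeroʳ n) (sum-≤-const absent)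
      where
      absent : ∀ i → (if lookup (S b) i then classWeight c i else 0) ℕ.≤ 0
      absent i with lookup (S b) i in i∈?Sb | lookup (I c) i in i∈?Ic
      ... | false | _     = z≤n
      ... | true  | false = z≤n
      -- A common item of `S b` and `I c` would put `c` among the classes of the bin, against `eq`.
      ... | true  | true  = contradiction
        (≡.trans (≡.sym eq) ([]=⇒lookup (∈-classes⁺
          (i , x∈p∩q⁺ (lookup⇒[]= i _ i∈?Sb , lookup⇒[]= i _ i∈?Ic)))))
        λ ()

    -- The bins containing class `c` offer it `d ∸ s c` each, so their number is an integer not
    -- below the quotient inside `γ c`, hence not below its ceiling.
    γ≤uses : ∀ c → γ c ℕ.≤ sumℕ (uses c)
    γ≤uses c = ∣⌈a/n⌉∣≤q (sumOver (I c) w) (d ∸ s c) (sumℕ (uses c)) {{d∸s-nonZero c}} (begin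
      sumOver (I c) w                              ≡⟨ sum-partition (proj₁ feasible) (classWeight c) ⟩
      sumℕ (λ b → sumOver (S b) (classWeight c))   ≤⟨ sum-mono-≤ (classWeight-in-bin c) ⟩
      sumℕ (λ b → uses c b ℕ.* (d ∸ s c))          ≡⟨ Σℕ.*-distribʳ-sum (d ∸ s c) (uses c) ⟨
      sumℕ (uses c) ℕ.* (d ∸ s c)                  ∎)
      where open ℕₚ.≤-Reasoning

    uses≤p : ∀ c → sumℕ (uses c) ℕ.≤ p
    uses≤p c = ≡.subst (sumℕ (uses c) ℕ.≤_) (ℕₚ.*-identityʳ p)
      (sum-≤-const λ b → if-≤ (lookup (classes (S b)) c) 1)

    γ≤bins : ∀ c → γ c ℕ.≤ p
    γ≤bins c = ℕₚ.≤-trans (γ≤uses c) (uses≤p c)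

    -- Replacing each `γ c` by the actual number of uses only increases the load, which then
    -- regroups by bin into pattern weights of at most `d`.
    load≤bins*d : load ℕ.≤ p ℕ.* d
    load≤bins*d = begin
      sumℕ w ℕ.+ sumℕ (λ c → γ c ℕ.* s c)
        ≤⟨ ℕₚ.+-mono-≤ (ℕₚ.≤-reflexive (sum-partition (proj₁ feasible) w))
             (sum-mono-≤ λ c → ℕₚ.*-monoˡ-≤ (s c) (γ≤uses c)) ⟩
      sumℕ (λ b → sumOver (S b) w) ℕ.+ sumℕ (λ c → sumℕ (uses c) ℕ.* s c)
        ≡⟨ ≡.cong (sumℕ (λ b → sumOver (S b) w) ℕ.+_) setups ⟩
      sumℕ (λ b → sumOver (S b) w) ℕ.+ sumℕ (λ b → sumOver (classes (S b)) s)
        ≡⟨ Σℕ.∑-distrib-+ (λ b → sumOver (S b) w) _ ⟨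
      sumℕ (λ b → sumOver (S b) w ℕ.+ sumOver (classes (S b)) s)
        ≤⟨ sum-≤-const (proj₂ feasible) ⟩
      p ℕ.* d ∎
      where
      open ℕₚ.≤-Reasoning
      -- The pairs of a class and a bin containing it are counted by class on the left and by bin on
      -- the right.
      setups : sumℕ (λ c → sumℕ (uses c) ℕ.* s c) ≡ sumℕ (λ b → sumOver (classes (S b)) s)
      setups = ≡.trans
        (Σℕ.sum-cong-≗ λ c → ≡.trans (Σℕ.*-distribʳ-sum (s c) (uses c))
          (Σℕ.sum-cong-≗ λ b → ≡.sym (if≡indicator* (lookup (classes (S b)) c) (s c))))
        (Σℕ.∑-comm {m} {p} _)

  module _ {k} (bounds : BoundsOptimalBins k) where

    γ≤k : ∀ c → γ c ℕ.≤ k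
    γ≤k c = decidable-stable (γ c ℕₚ.≤? k) λ γ≰k → ¬¬-optimal λ (p , S , optimal) →
      γ≰k (ℕₚ.≤-trans (γ≤bins (proj₁ optimal) c) (bounds S optimal))

    load≤k*d : load ℕ.≤ k ℕ.* d
    load≤k*d = decidable-stable (load ℕₚ.≤? k ℕ.* d) λ load≰kd → ¬¬-optimal λ (p , S , optimal) →
      load≰kd (ℕₚ.≤-trans (load≤bins*d (proj₁ optimal)) (ℕₚ.*-monoˡ-≤ d (bounds S optimal)))

-- Arithmetic in an ordered field.

module OrderedFieldProperties {a ℓ₁ ℓ₂} (K : OrderedField a ℓ₁ ℓ₂) where
  open OrderedField K hiding (zero)
  open IsTotalOrder isTotalOrder using (total; antisym; isPartialOrder)
  open RingProperties ring using (-‿distribʳ-*; -‿involutive; x[y-z]≈xy-xz)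
  open SemiringMult semiring using (×-homo-1; ×-homo-+; ×-congʳ; ×-assoc-*)
  open SemiringSum semiring using (sum-cong-≋; sum-replicate; *-distribˡ-sum; ∑-comm)

  poset : Poset a ℓ₁ ℓ₂
  poset = record { isPartialOrder = isPartialOrder }

  open ≤-Reasoning poset
  open Poset poset using () renaming (reflexive to ≤-reflexive; refl to ≤-refl; trans to ≤-trans)

  +-mono₂-≤ : ∀ {x y u v} → x ≤ y → u ≤ v → x + u ≤ y + v
  +-mono₂-≤ {x} {y} {u} {v} x≤y u≤v = begin
    x + u  ≤⟨ +-mono-≤ u x≤y ⟩
    y + u  ≈⟨ +-comm y u ⟩
    u + y  ≤⟨ +-mono-≤ y u≤v ⟩
    v + y  ≈⟨ +-comm v y ⟩
    y + v  ∎

  x≤y⇒0≤y-x : ∀ {x y} → x ≤ y → 0# ≤ y - x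
  x≤y⇒0≤y-x {x} {y} x≤y = begin
    0#     ≈⟨ -‿inverseʳ x ⟨
    x - x  ≤⟨ +-mono-≤ (- x) x≤y ⟩
    y - x  ∎

  *-monoˡ-≤ : ∀ {x y z} → 0# ≤ z → x ≤ y → z * x ≤ z * y
  *-monoˡ-≤ {x} {y} {z} 0≤z x≤y = begin
    z * x                       ≈⟨ +-identityˡ (z * x) ⟨
    0# + z * x                  ≤⟨ +-mono-≤ (z * x) (*-nonNeg 0≤z (x≤y⇒0≤y-x x≤y)) ⟩
    z * (y - x) + z * x         ≈⟨ +-congʳ (x[y-z]≈xy-xz z y x) ⟩
    z * y - z * x + z * x       ≈⟨ +-assoc (z * y) _ _ ⟩
    z * y + (- (z * x) + z * x) ≈⟨ +-congˡ (-‿inverseˡ (z * x)) ⟩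
    z * y + 0#                  ≈⟨ +-identityʳ (z * y) ⟩
    z * y                       ∎

  *-monoʳ-≤ : ∀ {x y z} → 0# ≤ z → x ≤ y → x * z ≤ y * z
  *-monoʳ-≤ {x} {y} {z} 0≤z x≤y = begin
    x * z  ≈⟨ *-comm x z ⟩
    z * x  ≤⟨ *-monoˡ-≤ 0≤z x≤y ⟩
    z * y  ≈⟨ *-comm z y ⟩
    y * z  ∎

  -- If `1# ≤ 0#`, then `- 1#` is non-negative, and so is its square, which is `1#`.
  0≤1 : 0# ≤ 1#
  0≤1 with total 0# 1#
  ... | inj₁ 0≤1 = 0≤1
  ... | inj₂ 1≤0 = begin
    0#             ≤⟨ *-nonNeg 0≤-1 0≤-1 ⟩
    - 1# * - 1#    ≈⟨ -‿distribʳ-* (- 1#) 1# ⟨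
    - (- 1# * 1#)  ≈⟨ -‿cong (*-identityʳ (- 1#)) ⟩
    - - 1#         ≈⟨ -‿involutive 1# ⟩
    1#             ∎
    where
    0≤-1 : 0# ≤ - 1#
    0≤-1 = ≤-trans (x≤y⇒0≤y-x 1≤0) (≤-reflexive (+-identityˡ (- 1#)))

  sum-mono-≤ᴷ : ∀ {n} {t u : Fin n → Carrier} → (∀ i → t i ≤ u i) → sum t ≤ sum u
  sum-mono-≤ᴷ = foldr-cong {R = _≤_} {S = _≤_} +-mono₂-≤ ≤-refl

  ⟦⟧-nonNeg : ∀ j → 0# ≤ ⟦ j ⟧
  ⟦⟧-nonNeg zero    = ≤-refl
  ⟦⟧-nonNeg (suc j) = ≤-trans (≤-reflexive (sym (+-identityˡ 0#))) (+-mono₂-≤ 0≤1 (⟦⟧-nonNeg j))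

  ⟦⟧-mono-≤ : ∀ {i j} → i ℕ.≤ j → ⟦ i ⟧ ≤ ⟦ j ⟧
  ⟦⟧-mono-≤ {j = j} z≤n       = ⟦⟧-nonNeg j
  ⟦⟧-mono-≤         (s≤s i≤j) = +-mono₂-≤ ≤-refl (⟦⟧-mono-≤ i≤j)

  ⟦1⟧≈1 : ⟦ 1 ⟧ ≈ 1#
  ⟦1⟧≈1 = ×-homo-1 1#

  -- An ordered field has characteristic zero: the image of a positive number is at least `1#`, so
  -- its vanishing would identify `0#` and `1#`.
  ⟦⟧≉0 : ∀ j .{{_ : NonZero j}} → ¬ ⟦ j ⟧ ≈ 0#
  ⟦⟧≉0 j@(suc _) j≈0 = 0≉1 (antisym 0≤1 (begin
    1#     ≈⟨ ⟦1⟧≈1 ⟨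
    ⟦ 1 ⟧  ≤⟨ ⟦⟧-mono-≤ {1} {j} (s≤s z≤n) ⟩
    ⟦ j ⟧  ≈⟨ j≈0 ⟩
    0#     ∎))

  ⟦⟧-sum : ∀ {n} (t : Fin n → ℕ) → ⟦ sumℕ t ⟧ ≈ sum (λ i → ⟦ t i ⟧)
  ⟦⟧-sum {zero}  t = refl
  ⟦⟧-sum {suc n} t = trans (×-homo-+ 1# (t zero) _) (+-congˡ (⟦⟧-sum λ i → t (suc i)))

  -- A non-positive inverse would give `1# ≈ x * x ⁻¹ ≤ 0#`.
  ⁻¹-nonNeg : ∀ {x} → 0# ≤ x → ¬ x ≈ 0# → 0# ≤ x ⁻¹
  ⁻¹-nonNeg {x} 0≤x x≉0 with total 0# (x ⁻¹)
  ... | inj₁ 0≤x⁻¹ = 0≤x⁻¹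
  ... | inj₂ x⁻¹≤0 = contradiction (antisym 0≤1 (begin
    1#        ≈⟨ *-inverseʳ x≉0 ⟨
    x * x ⁻¹  ≤⟨ *-monoˡ-≤ 0≤x x⁻¹≤0 ⟩
    x * 0#    ≈⟨ zeroʳ x ⟩
    0#        ∎)) 0≉1

  y*[x/y]≈x : ∀ {x y} → ¬ y ≈ 0# → y * (x / y) ≈ x
  y*[x/y]≈x {x} {y} y≉0 = begin-equality
    y * (x * y ⁻¹)  ≈⟨ *-congˡ (*-comm x (y ⁻¹)) ⟩
    y * (y ⁻¹ * x)  ≈⟨ *-assoc y (y ⁻¹) x ⟨
    y * y ⁻¹ * x    ≈⟨ *-congʳ (*-inverseʳ y≉0) ⟩
    1# * x          ≈⟨ *-identityˡ x ⟩
    x               ∎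

  [x/y]*[y*z]≈x*z : ∀ {x y z} → ¬ y ≈ 0# → (x / y) * (y * z) ≈ x * z
  [x/y]*[y*z]≈x*z {x} {y} {z} y≉0 = begin-equality
    (x / y) * (y * z)  ≈⟨ *-assoc (x / y) y z ⟨
    (x / y) * y * z    ≈⟨ *-congʳ (*-comm (x / y) y) ⟩
    y * (x / y) * z    ≈⟨ *-congʳ (y*[x/y]≈x y≉0) ⟩
    x * z              ∎

  *-cancelˡ : ∀ {x y z} → ¬ z ≈ 0# → z * x ≈ z * y → x ≈ y
  *-cancelˡ {x} {y} {z} z≉0 zx≈zy = begin-equality
    x                  ≈⟨ *-identityˡ x ⟨
    1# * x             ≈⟨ [x/y]*[y*z]≈x*z z≉0 ⟨
    (1# / z) * (z * x) ≈⟨ *-congˡ zx≈zy ⟩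
    (1# / z) * (z * y) ≈⟨ [x/y]*[y*z]≈x*z z≉0 ⟩
    1# * y             ≈⟨ *-identityˡ y ⟩
    y                  ∎

  /-nonNeg : ∀ {x y} → 0# ≤ x → 0# ≤ y → ¬ y ≈ 0# → 0# ≤ x / y
  /-nonNeg 0≤x 0≤y y≉0 = *-nonNeg 0≤x (⁻¹-nonNeg 0≤y y≉0)

  /-≤1 : ∀ {x y} → x ≤ y → 0# ≤ y → ¬ y ≈ 0# → x / y ≤ 1#
  /-≤1 {x} {y} x≤y 0≤y y≉0 = begin
    x * y ⁻¹  ≤⟨ *-monoʳ-≤ (⁻¹-nonNeg 0≤y y≉0) x≤y ⟩
    y * y ⁻¹  ≈⟨ *-inverseʳ y≉0 ⟩
    1#        ∎

  sum-const : ∀ k x → sum {k} (λ _ → x) ≈ ⟦ k ⟧ * x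
  sum-const k x = trans (sum-replicate k)
    (trans (×-congʳ k (sym (*-identityˡ x))) (sym (×-assoc-* k 1# x)))

  sum-shares : ∀ k x .{{_ : NonZero k}} → sum {k} (λ _ → x / ⟦ k ⟧) ≈ x
  sum-shares k x = trans (sum-const k (x / ⟦ k ⟧)) (y*[x/y]≈x (⟦⟧≉0 k))

  -- Brings the sum over bins next to the variables, where the assignment and minimum classes
  -- constraints speak about it.
  sum-weighted-swap : ∀ {n k} (u : Fin n → Carrier) (t : Fin n → Fin k → Carrier) →
    sum (λ b → sum λ i → u i * t i b) ≈ sum (λ i → u i * sum (t i))
  sum-weighted-swap {n} {k} u t = begin-equality
    sum (λ b → sum λ i → u i * t i b)  ≈⟨ ∑-comm {k} {n} _ ⟩
    sum (λ i → sum λ b → u i * t i b)  ≈⟨ sum-cong-≋ (λ i → *-distribˡ-sum (u i) (t i)) ⟨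
    sum (λ i → u i * sum (t i))        ∎

-- The lower bound on the objective.

module Relaxation {a ℓ₁ ℓ₂} (K : OrderedField a ℓ₁ ℓ₂) (P : BPPS) (k : ℕ) where
  open OrderedField K
  open BPPS P
  open LP K P k
  open OrderedFieldProperties K
  open ≤-Reasoning poset
  open SemiringMult semiring using (×-homo-+; ×1-homo-*)
  open SemiringSum semiring using (sum-cong-≋; *-distribˡ-sum; ∑-distrib-+)
  open Poset poset using () renaming (reflexive to ≤-reflexive; refl to ≤-refl; trans to ≤-trans)

  instance
    d-nonZero : NonZero d
    d-nonZero = ℕ.>-nonZero d≥1

  -- The left-hand side of the capacity constraint.
  binLoad : Point → Fin k → Carrier
  binLoad q b = sum (λ i → ⟦ w i ⟧ * x i b) + sum (λ c → ⟦ s c ⟧ * y c b)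
    where open Point q

  value : Carrier
  value = (⟦ r ⟧ / ⟦ d ⟧) * ⟦ load ⟧ + sum (λ c → ⟦ γ c ⟧ * ⟦ f c ⟧)

  -- Writing `r z` as `(r / d) (d z)` exposes the right-hand sides of the capacity constraints.
  objective-split : ∀ q → let open Point q in
    objective q ≈ (⟦ r ⟧ / ⟦ d ⟧) * sum (λ b → ⟦ d ⟧ * z b) + sum (λ c → ⟦ f c ⟧ * sum (y c))
  objective-split q = begin-equality
    sum (λ b → ⟦ r ⟧ * z b + sum λ c → ⟦ f c ⟧ * y c b)
      ≈⟨ ∑-distrib-+ (λ b → ⟦ r ⟧ * z b) _ ⟩
    sum (λ b → ⟦ r ⟧ * z b) + sum (λ b → sum λ c → ⟦ f c ⟧ * y c b)
      ≈⟨ +-cong (sum-cong-≋ {k} λ b → sym ([x/y]*[y*z]≈x*z (⟦⟧≉0 d))) (sum-weighted-swap _ y) ⟩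
    sum (λ b → (⟦ r ⟧ / ⟦ d ⟧) * (⟦ d ⟧ * z b)) + sum (λ c → ⟦ f c ⟧ * sum (y c))
      ≈⟨ +-congʳ (*-distribˡ-sum (⟦ r ⟧ / ⟦ d ⟧) (λ b → ⟦ d ⟧ * z b)) ⟨
    (⟦ r ⟧ / ⟦ d ⟧) * sum (λ b → ⟦ d ⟧ * z b) + sum (λ c → ⟦ f c ⟧ * sum (y c)) ∎
    where open Point q

  -- The assignment equations make the item part independent of `q`. The sums of `y` stay, since
  -- feasibility does not fix them: they are at least `γ c`, with equality at the even point.
  binLoad-total : ∀ q → let open Point q in (∀ i → sum (x i) ≈ 1#) →
    sum (binLoad q) ≈ ⟦ sumℕ w ⟧ + sum (λ c → ⟦ s c ⟧ * sum (y c))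
  binLoad-total q assigned = begin-equality
    sum (binLoad q)
      ≈⟨ ∑-distrib-+ (λ b → sum λ i → ⟦ w i ⟧ * x i b) _ ⟩
    sum (λ b → sum λ i → ⟦ w i ⟧ * x i b) + sum (λ b → sum λ c → ⟦ s c ⟧ * y c b)
      ≈⟨ +-cong (sum-weighted-swap _ x) (sum-weighted-swap _ y) ⟩
    sum (λ i → ⟦ w i ⟧ * sum (x i)) + sum (λ c → ⟦ s c ⟧ * sum (y c))
      ≈⟨ +-congʳ (sum-cong-≋ λ i → trans (*-congˡ (assigned i)) (*-identityʳ ⟦ w i ⟧)) ⟩
    sum (λ i → ⟦ w i ⟧) + sum (λ c → ⟦ s c ⟧ * sum (y c))
      ≈⟨ +-congʳ (⟦⟧-sum w) ⟨
    ⟦ sumℕ w ⟧ + sum (λ c → ⟦ s c ⟧ * sum (y c)) ∎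
    where open Point q

  ⟦load⟧ : ⟦ load ⟧ ≈ ⟦ sumℕ w ⟧ + sum (λ c → ⟦ s c ⟧ * ⟦ γ c ⟧)
  ⟦load⟧ = begin-equality
    ⟦ load ⟧
      ≈⟨ ×-homo-+ 1# (sumℕ w) _ ⟩
    ⟦ sumℕ w ⟧ + ⟦ sumℕ (λ c → γ c ℕ.* s c) ⟧
      ≈⟨ +-congˡ (⟦⟧-sum λ c → γ c ℕ.* s c) ⟩
    ⟦ sumℕ w ⟧ + sum (λ c → ⟦ γ c ℕ.* s c ⟧)
      ≈⟨ +-congˡ (sum-cong-≋ λ c → trans (×1-homo-* (γ c) (s c)) (*-comm ⟦ γ c ⟧ ⟦ s c ⟧)) ⟩
    ⟦ sumℕ w ⟧ + sum (λ c → ⟦ s c ⟧ * ⟦ γ c ⟧) ∎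

  -- All coefficients are non-negative, so the constraints can be scaled and added. `min-classes`
  -- enters twice: for the setup costs, and inside `load≤` for the setup weights.
  value≤objective : ∀ q → Feasible q → value ≤ objective q
  value≤objective q feasible = begin
    (⟦ r ⟧ / ⟦ d ⟧) * ⟦ load ⟧ + sum (λ c → ⟦ γ c ⟧ * ⟦ f c ⟧)
      ≈⟨ +-congˡ (sum-cong-≋ λ c → *-comm ⟦ γ c ⟧ ⟦ f c ⟧) ⟩
    (⟦ r ⟧ / ⟦ d ⟧) * ⟦ load ⟧ + sum (λ c → ⟦ f c ⟧ * ⟦ γ c ⟧)
      ≤⟨ +-mono₂-≤ (*-monoˡ-≤ 0≤r/d load≤)
           (sum-mono-≤ᴷ λ c → *-monoˡ-≤ (⟦⟧-nonNeg (f c)) (min-classes c)) ⟩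
    (⟦ r ⟧ / ⟦ d ⟧) * sum (λ b → ⟦ d ⟧ * z b) + sum (λ c → ⟦ f c ⟧ * sum (y c))
      ≈⟨ objective-split q ⟨
    objective q ∎
    where
    open Point q
    open Feasible feasible
    0≤r/d : 0# ≤ ⟦ r ⟧ / ⟦ d ⟧
    0≤r/d = /-nonNeg (⟦⟧-nonNeg r) (⟦⟧-nonNeg d) (⟦⟧≉0 d)
    load≤ : ⟦ load ⟧ ≤ sum (λ b → ⟦ d ⟧ * z b)
    load≤ = begin
      ⟦ load ⟧
        ≈⟨ ⟦load⟧ ⟩
      ⟦ sumℕ w ⟧ + sum (λ c → ⟦ s c ⟧ * ⟦ γ c ⟧)
        ≤⟨ +-mono₂-≤ ≤-refl (sum-mono-≤ᴷ λ c → *-monoˡ-≤ (⟦⟧-nonNeg (s c)) (min-classes c)) ⟩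
      ⟦ sumℕ w ⟧ + sum (λ c → ⟦ s c ⟧ * sum (y c))
        ≈⟨ binLoad-total q assignment ⟨
      sum (binLoad q)
        ≤⟨ sum-mono-≤ᴷ capacity ⟩
      sum (λ b → ⟦ d ⟧ * z b) ∎

  -- The even point: feasibility and attainment of the bound.

  module _ {{k-nonZero : NonZero k}} where

    evenPoint : Point
    evenPoint = point (λ i b → 1# / ⟦ k ⟧) (λ c b → ⟦ γ c ⟧ / ⟦ k ⟧) (λ b → ⟦ load ⟧ / (⟦ k ⟧ * ⟦ d ⟧))

    open Point evenPoint

    k≉0 : ¬ ⟦ k ⟧ ≈ 0#
    k≉0 = ⟦⟧≉0 k

    -- Transferred from the naturals, where a product of nonzero numbers is nonzero.
    k*d≉0 : ¬ ⟦ k ⟧ * ⟦ d ⟧ ≈ 0#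
    k*d≉0 kd≈0 = ⟦⟧≉0 (k ℕ.* d) {{ℕₚ.m*n≢0 k d}} (trans (×1-homo-* k d) kd≈0)

    total-capacity : sum (λ b → ⟦ d ⟧ * z b) ≈ ⟦ load ⟧
    total-capacity = begin-equality
      sum {k} (λ _ → ⟦ d ⟧ * (⟦ load ⟧ / (⟦ k ⟧ * ⟦ d ⟧)))  ≈⟨ sum-const k _ ⟩
      ⟦ k ⟧ * (⟦ d ⟧ * (⟦ load ⟧ / (⟦ k ⟧ * ⟦ d ⟧)))        ≈⟨ *-assoc ⟦ k ⟧ ⟦ d ⟧ _ ⟨
      ⟦ k ⟧ * ⟦ d ⟧ * (⟦ load ⟧ / (⟦ k ⟧ * ⟦ d ⟧))          ≈⟨ y*[x/y]≈x k*d≉0 ⟩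
      ⟦ load ⟧                                              ∎

    total-y : ∀ c → sum (y c) ≈ ⟦ γ c ⟧
    total-y c = sum-shares k ⟦ γ c ⟧

    objective-evenPoint : objective evenPoint ≈ value
    objective-evenPoint = trans (objective-split evenPoint) (+-cong (*-congˡ total-capacity)
      (sum-cong-≋ λ c → trans (*-congˡ (total-y c)) (*-comm ⟦ f c ⟧ ⟦ γ c ⟧)))

    -- All bins carry the same load, so the capacity constraints are tight as
    -- soon as they are tight in total.
    binLoad-evenPoint : ∀ b → binLoad evenPoint b ≈ ⟦ d ⟧ * z b
    binLoad-evenPoint b = *-cancelˡ k≉0 (begin-equality
      ⟦ k ⟧ * binLoad evenPoint b                   ≈⟨ sum-const k _ ⟨
      sum (binLoad evenPoint)                       ≈⟨ binLoad-total evenPoint (λ _ → sum-shares k 1#) ⟩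
      ⟦ sumℕ w ⟧ + sum (λ c → ⟦ s c ⟧ * sum (y c))  ≈⟨ +-congˡ (sum-cong-≋ λ c → *-congˡ (total-y c)) ⟩
      ⟦ sumℕ w ⟧ + sum (λ c → ⟦ s c ⟧ * ⟦ γ c ⟧)    ≈⟨ ⟦load⟧ ⟨
      ⟦ load ⟧                                      ≈⟨ total-capacity ⟨
      sum (λ b → ⟦ d ⟧ * z b)                       ≈⟨ sum-const k _ ⟩
      ⟦ k ⟧ * (⟦ d ⟧ * z b)                         ∎)

    evenPoint-feasible : BoundsOptimalBins k → Feasible evenPoint
    evenPoint-feasible bounds = record
      { assignment  = λ i → sum-shares k 1#
      ; capacity    = λ b → ≤-reflexive (binLoad-evenPoint b)
      -- Dividing `1 ≤ γ c` by `k` gives the inequality.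
      ; setup       = λ c i _ b → *-monoʳ-≤ (⁻¹-nonNeg 0≤k k≉0) (1≤⟦⟧ (1≤γ c))
      ; min-classes = λ c → ≤-reflexive (sym (total-y c))
      ; x-bounds    = λ i b → /-nonNeg 0≤1 0≤k k≉0 , /-≤1 (1≤⟦⟧ (ℕ.>-nonZero⁻¹ k)) 0≤k k≉0
      ; y-bounds    = λ c b → /-nonNeg (⟦⟧-nonNeg (γ c)) 0≤k k≉0 , /-≤1 (⟦⟧-mono-≤ (γ≤k bounds c)) 0≤k k≉0
      ; z-bounds    = λ b → /-nonNeg (⟦⟧-nonNeg load) 0≤k*d k*d≉0 , /-≤1 load≤ 0≤k*d k*d≉0
      }
      where
      open Packings P
      0≤k : 0# ≤ ⟦ k ⟧
      0≤k = ⟦⟧-nonNeg k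
      0≤k*d : 0# ≤ ⟦ k ⟧ * ⟦ d ⟧
      0≤k*d = *-nonNeg 0≤k (⟦⟧-nonNeg d)
      1≤⟦⟧ : ∀ {j} → 1 ℕ.≤ j → 1# ≤ ⟦ j ⟧
      1≤⟦⟧ 1≤j = ≤-trans (≤-reflexive (sym ⟦1⟧≈1)) (⟦⟧-mono-≤ 1≤j)
      load≤ : ⟦ load ⟧ ≤ ⟦ k ⟧ * ⟦ d ⟧
      load≤ = ≤-trans (⟦⟧-mono-≤ (load≤k*d bounds)) (≤-reflexive (×1-homo-* k d))

    evenPoint-optimal : BoundsOptimalBins k → IsOptimalSolution evenPoint
    evenPoint-optimal bounds = evenPoint-feasible bounds , λ q feasible →
      ≤-trans (≤-reflexive objective-evenPoint) (value≤objective q feasible)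

proposition4 :
  ∀ {a ℓ₁ ℓ₂} (K : OrderedField a ℓ₁ ℓ₂) (P : BPPS) (k : ℕ) →
  let open OrderedField K
      open BPPS P
      open LP K P k
  in
  1 ℕ.≤ k →
  BoundsOptimalBins k →
  IsOptimalSolution
    (point (λ i b → 1# / ⟦ k ⟧)
           (λ c b → ⟦ γ c ⟧ / ⟦ k ⟧)
           (λ b → ⟦ load ⟧ / (⟦ k ⟧ * ⟦ d ⟧)))
  ×
  IsOptimalValue ((⟦ r ⟧ / ⟦ d ⟧) * ⟦ load ⟧ + sum (λ c → ⟦ γ c ⟧ * ⟦ f c ⟧))
proposition4 K P k 1≤k bounds =
  evenPoint-optimal bounds , evenPoint , evenPoint-optimal bounds , objective-evenPoint
  where
  open Relaxation K P k
  instance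
    k-nonZero : NonZero k
    k-nonZero = ℕ.>-nonZero 1≤k
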